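{- For every nonnegative integer $n$, $$\sum_{j=0}^{\infty}pod(j)\,p(n-j)=\sum_{j=0}^{\infty}a(j)\,q_{odd}(n-j).$$
   Context: $pod(n)$ denotes the number of partitions of $n$ in which odd parts are distinct and even parts may be repeated; $p(n)$ denotes the number of (unrestricted) partitions of $n$; $a(n)$ is the cubic partition function, i.e. the number of partitions of $n$ in which the even parts can appear in two colors, with generating function $\sum_{n\ge0}a(n)q^n=\prod_{k\ge1}\frac{1}{(1-q^k)(1-q^{2k})}$; $q_{odd}(n)$ denotes the number of partitions of $n$ into distinct odd parts. Each of these functions is $1$ at $0$ and $0$ at negative arguments. -}

module Defs where

open import Data.Fin.Base as Fin using (Fin)
import Data.Fin.Properties as Fin
open import Data.List.Base
  using (List; []; _∷_; length; map; filter; upTo; allFin;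
         cartesianProduct; cartesianProductWith)
open import Data.List.Membership.Propositional using (_∈_)
open import Data.List.Membership.Propositional.Properties
  using (∈-upTo⁺; ∈-allFin; ∈-cartesianProduct⁺; ∈-cartesianProductWith⁺;
         ∈-cartesianProductWith⁻; ∈-filter⁺; ∈-filter⁻; ∈-map⁺)
open import Data.List.Properties using (length-map; ∷-injective)
open import Data.List.Relation.Unary.All as All using (All; []; _∷_)
open import Data.List.Relation.Unary.Any using (here; there)
open import Data.List.Relation.Unary.Linked as Linked using (Linked)
open import Data.List.Relation.Unary.Unique.Propositional
  using (Unique; []; _∷_)
import Data.List.Relation.Unary.Unique.Propositional.Properties as Unique
open import Data.Nat.Base
open import Data.Nat.Divisibility using (_∣_; _∣?_)
open import Data.Nat.ListAction using (sum)
open import Data.Nat.Properties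
open import Data.List.Relation.Unary.Unique.DecPropositional _≟_ using (unique?)
open import Data.Product.Base using (_×_; _,_; proj₁; proj₂)
open import Data.Product.Relation.Binary.Lex.Strict using (×-Lex; ×-decidable)
open import Function.Base using (_∘_)
open import Function.Bundles using (_⇔_; mk⇔)
open import Relation.Binary.Core using (Rel)
import Relation.Binary.Definitions as B
open import Relation.Binary.PropositionalEquality
  using (_≡_; refl; subst)
open import Relation.Nullary.Decidable using (_×-dec_; _→-dec_; ¬?)
open import Relation.Nullary.Negation using (¬_)
open import Relation.Unary using (Decidable)
open import Level using (0ℓ)

Odd : ℕ → Set
Odd m = ¬ (2 ∣ m)

odd? : Decidable Odd
odd? m = ¬? (2 ∣? m)

IsPartition : ℕ → List ℕ → Set
IsPartition n xs = Linked _≥_ xs × All (0 <_) xs × sum xs ≡ n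

IsPodPartition : ℕ → List ℕ → Set
IsPodPartition n xs = IsPartition n xs × Unique (filter odd? xs)

IsDistinctOddPartition : ℕ → List ℕ → Set
IsDistinctOddPartition n xs = IsPartition n xs × All Odd xs × Unique xs

ColouredPart : Set
ColouredPart = ℕ × Fin 2

-- Listing coloured parts by decreasing size, and by decreasing colour among
-- parts of equal size, makes each multiset of coloured parts correspond to
-- exactly one list.

infix 4 _≽_

_≽_ : Rel ColouredPart 0ℓ
_≽_ = ×-Lex _≡_ _>_ Fin._≥_

-- Only even parts have a choice of colour: odd parts always have colour zero.

IsCubicPartition : ℕ → List ColouredPart → Set
IsCubicPartition n cs =
  IsPartition n (map proj₁ cs) ×
  Linked _≽_ cs ×
  All (λ c → Odd (proj₁ c) → proj₂ c ≡ Fin.zero) cs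

isPartition? : ∀ n → Decidable (IsPartition n)
isPartition? n xs =
  Linked.linked? _≥?_ xs ×-dec All.all? (0 <?_) xs ×-dec sum xs ≟ n

isPodPartition? : ∀ n → Decidable (IsPodPartition n)
isPodPartition? n xs = isPartition? n xs ×-dec unique? (filter odd? xs)

isDistinctOddPartition? : ∀ n → Decidable (IsDistinctOddPartition n)
isDistinctOddPartition? n xs =
  isPartition? n xs ×-dec All.all? odd? xs ×-dec unique? xs

_≽?_ : B.Decidable _≽_
_≽?_ = ×-decidable _≟_ _>?_ (λ c d → d Fin.≤? c)

isCubicPartition? : ∀ n → Decidable (IsCubicPartition n)
isCubicPartition? n cs =
  isPartition? n (map proj₁ cs) ×-dec
  Linked.linked? _≽?_ cs ×-dec
  All.all? (λ c → odd? (proj₁ c) →-dec proj₂ c Fin.≟ Fin.zero) cs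

-- A partition of n has at most n parts, each at most n, so the partitions are
-- found among the lists of length at most n over a finite alphabet.

lists≤ : {A : Set} → List A → ℕ → List (List A)
lists≤ as zero    = [] ∷ []
lists≤ as (suc k) = [] ∷ cartesianProductWith _∷_ as (lists≤ as k)

candidates : ℕ → List (List ℕ)
candidates n = lists≤ (upTo (suc n)) n

colouredCandidates : ℕ → List (List ColouredPart)
colouredCandidates n = lists≤ (cartesianProduct (upTo (suc n)) (allFin 2)) n

partitions : ℕ → List (List ℕ)
partitions n = filter (isPartition? n) (candidates n)

podPartitions : ℕ → List (List ℕ)
podPartitions n = filter (isPodPartition? n) (candidates n)

distinctOddPartitions : ℕ → List (List ℕ)
distinctOddPartitions n = filter (isDistinctOddPartition? n) (candidates n)

cubicPartitions : ℕ → List (List ColouredPart)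
cubicPartitions n = filter (isCubicPartition? n) (colouredCandidates n)

p pod q-odd a : ℕ → ℕ
p     n = length (partitions n)
pod   n = length (podPartitions n)
q-odd n = length (distinctOddPartitions n)
a     n = length (cubicPartitions n)

-- Σ_{j ≥ 0} f(j) g(n - j) for g vanishing at negative arguments: the terms
-- with j > n are zero, so j ranges over 0, …, n.

convolution : (ℕ → ℕ) → (ℕ → ℕ) → ℕ → ℕ
convolution f g n = sum (map (λ j → f j * g (n ∸ j)) (upTo (suc n)))

-- The enumerations contain exactly the intended lists, without repetition,
-- so their lengths are the intended numbers of partitions.

private
  ∈-lists≤ : ∀ {A : Set} {as : List A} {xs} k →
             All (_∈ as) xs → length xs ≤ k → xs ∈ lists≤ as k
  ∈-lists≤ zero    []       _       = here refl
  ∈-lists≤ (suc k) []       _       = here refl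
  ∈-lists≤ (suc k) (x ∷ xs) (s≤s l) =
    there (∈-cartesianProductWith⁺ _∷_ x (∈-lists≤ k xs l))

  lists≤-unique : ∀ {A : Set} {as : List A} → Unique as →
                  ∀ k → Unique (lists≤ as k)
  lists≤-unique u zero    = [] ∷ []
  lists≤-unique {as = as} u (suc k) =
    All.tabulate nonempty ∷
    Unique.cartesianProductWith⁺ _∷_ ∷-injective u (lists≤-unique u k)
    where
    nonempty : ∀ {ys} → ys ∈ cartesianProductWith _∷_ as (lists≤ as k) →
               ¬ [] ≡ ys
    nonempty m eq with ∈-cartesianProductWith⁻ _∷_ as (lists≤ as k) m | eq
    ... | _ , _ , _ , _ , refl | ()

  length≤sum : ∀ {xs} → All (0 <_) xs → length xs ≤ sum xs
  length≤sum []         = z≤n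
  length≤sum (0<x ∷ ps) = +-mono-≤ 0<x (length≤sum ps)

  ∈⇒≤sum : ∀ {x xs} → x ∈ xs → x ≤ sum xs
  ∈⇒≤sum {xs = y ∷ ys} (here refl) = m≤m+n y (sum ys)
  ∈⇒≤sum {xs = y ∷ ys} (there m)   = ≤-trans (∈⇒≤sum m) (m≤n+m (sum ys) y)

  ∈-candidates : ∀ {n xs} → IsPartition n xs → xs ∈ candidates n
  ∈-candidates (_ , pos , refl) =
    ∈-lists≤ _ (All.tabulate (∈-upTo⁺ ∘ s≤s ∘ ∈⇒≤sum)) (length≤sum pos)

  ∈-colouredCandidates : ∀ {n cs} → IsPartition n (map proj₁ cs) →
                         cs ∈ colouredCandidates n
  ∈-colouredCandidates {cs = cs} (_ , pos , refl) =
    ∈-lists≤ _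
      (All.tabulate λ m → ∈-cartesianProduct⁺
        (∈-upTo⁺ (s≤s (∈⇒≤sum (∈-map⁺ proj₁ m)))) (∈-allFin _))
      (subst (_≤ sum (map proj₁ cs)) (length-map proj₁ cs) (length≤sum pos))

  candidates-unique : ∀ n → Unique (candidates n)
  candidates-unique n = lists≤-unique (Unique.upTo⁺ (suc n)) n

  colouredCandidates-unique : ∀ n → Unique (colouredCandidates n)
  colouredCandidates-unique n =
    lists≤-unique (Unique.cartesianProduct⁺ (Unique.upTo⁺ (suc n))
                                            (Unique.allFin⁺ 2)) n

  ∈-filter⇔ : ∀ {A : Set} {P : A → Set} (P? : Decidable P) {xs x} →
              (P x → x ∈ xs) → x ∈ filter P? xs ⇔ P x
  ∈-filter⇔ P? {xs} c =
    mk⇔ (proj₂ ∘ ∈-filter⁻ P? {xs = xs}) (λ px → ∈-filter⁺ P? (c px) px)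

∈-partitions : ∀ {n xs} → xs ∈ partitions n ⇔ IsPartition n xs
∈-partitions = ∈-filter⇔ (isPartition? _) ∈-candidates

∈-podPartitions : ∀ {n xs} → xs ∈ podPartitions n ⇔ IsPodPartition n xs
∈-podPartitions = ∈-filter⇔ (isPodPartition? _) (∈-candidates ∘ proj₁)

∈-distinctOddPartitions : ∀ {n xs} →
  xs ∈ distinctOddPartitions n ⇔ IsDistinctOddPartition n xs
∈-distinctOddPartitions =
  ∈-filter⇔ (isDistinctOddPartition? _) (∈-candidates ∘ proj₁)

∈-cubicPartitions : ∀ {n cs} → cs ∈ cubicPartitions n ⇔ IsCubicPartition n cs
∈-cubicPartitions =
  ∈-filter⇔ (isCubicPartition? _) (∈-colouredCandidates ∘ proj₁)

partitions-unique : ∀ n → Unique (partitions n)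
partitions-unique n = Unique.filter⁺ (isPartition? n) (candidates-unique n)

podPartitions-unique : ∀ n → Unique (podPartitions n)
podPartitions-unique n =
  Unique.filter⁺ (isPodPartition? n) (candidates-unique n)

distinctOddPartitions-unique : ∀ n → Unique (distinctOddPartitions n)
distinctOddPartitions-unique n =
  Unique.filter⁺ (isDistinctOddPartition? n) (candidates-unique n)

cubicPartitions-unique : ∀ n → Unique (cubicPartitions n)
cubicPartitions-unique n =
  Unique.filter⁺ (isCubicPartition? n) (colouredCandidates-unique n)

{-# OPTIONS --safe #-}

-- Split a partition with distinct odd parts into its odd and its even parts.
-- The odd parts form a partition into distinct odd parts; the even parts, in
-- the second colour, together with an arbitrary partition, in the first
-- colour, form a cubic partition. This is a bijection between the pairs
-- counted by the two sides. Partitions being sorted lists, each is determined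
-- by its multiset of parts, so all identities reduce to permutations.

module Submission where

open import Defs using (pod; p; a; q-odd; convolution)
open import Defs
  using (Odd; odd?; IsPartition; IsPodPartition; IsDistinctOddPartition;
         IsCubicPartition; ColouredPart; _≽_; _≽?_;
         partitions; podPartitions; distinctOddPartitions; cubicPartitions;
         ∈-partitions; ∈-podPartitions; ∈-distinctOddPartitions;
         ∈-cubicPartitions; partitions-unique; podPartitions-unique;
         distinctOddPartitions-unique; cubicPartitions-unique)
import Data.Fin.Base as Fin
import Data.Fin.Properties as Fin
open import Data.List.Base
  using (List; []; _∷_; _++_; length; map; filter; concat; upTo;
         cartesianProduct)
open import Data.List.Membership.Propositional using (_∈_)
open import Data.List.Membership.Propositional.Properties
  using (∈-map⁺; ∈-map⁻; ∈-upTo⁺; ∈-upTo⁻; ∈-concat⁺′; ∈-concat⁻′;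
         ∈-cartesianProduct⁺; ∈-cartesianProduct⁻)
open import Data.List.Membership.Propositional.Properties.WithK
  using (unique∧set⇒bag)
open import Data.List.Properties
  using (length-map; length-++; map-∘; map-cong; map-id-local; map-++;
         filter-++; filter-all; filter-none; ++-identityʳ)
open import Data.List.Relation.Binary.BagAndSetEquality using (∼bag⇒↭)
open import Data.List.Relation.Binary.Permutation.Propositional
  using (_↭_; ↭-reflexive; ↭-sym; ↭-trans; ↭⇒↭ₛ; module PermutationReasoning)
import Data.List.Relation.Binary.Permutation.Propositional.Properties as Perm
import Data.List.Relation.Binary.Permutation.Setoid.Properties as PermSetoid
import Data.List.Relation.Binary.Pointwise as Pointwise
open import Data.List.Relation.Ternary.Interleaving.Propositional
  using (toPermutation)
import Data.List.Relation.Ternary.Interleaving.Setoid.Properties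
  as Interleaving
open import Data.List.Relation.Unary.All as All using (All)
import Data.List.Relation.Unary.All.Properties as All
import Data.List.Relation.Unary.AllPairs as AllPairs
import Data.List.Relation.Unary.AllPairs.Properties as AllPairs
open import Data.List.Relation.Unary.Linked as Linked using (Linked)
import Data.List.Relation.Unary.Linked.Properties as Linked
open import Data.List.Relation.Unary.Sorted.TotalOrder.Properties
  using (↗↭↗⇒≋)
open import Data.List.Relation.Unary.Unique.Propositional using (Unique)
import Data.List.Relation.Unary.Unique.Propositional.Properties as Unique
import Data.List.Sort as Sort
open import Data.Nat.Base
open import Data.Nat.ListAction using (sum)
open import Data.Nat.ListAction.Properties using (sum-++; sum-↭)
open import Data.Nat.Properties
open import Data.Product.Base using (_×_; _,_; proj₁; proj₂; ∃₂)
open import Data.Product.Properties using (≡-dec)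
open import Data.Product.Relation.Binary.Lex.Strict
  using (×-transitive; ×-total₂)
open import Data.Sum.Base using (inj₁; inj₂)
open import Function.Base using (_∘_; flip)
open import Function.Bundles using (mk⇔; module Equivalence)
open import Level using (0ℓ)
open import Relation.Binary.Bundles using (DecTotalOrder)
import Relation.Binary.Construct.Flip.EqAndOrd as Flip
open import Relation.Binary.Core using (Rel)
open import Relation.Binary.Structures using (IsDecTotalOrder)
open import Relation.Binary.PropositionalEquality
  using (_≡_; _≢_; refl; sym; trans; cong; cong₂; subst; resp₂; setoid;
         isEquivalence; module ≡-Reasoning)
open import Relation.Nullary.Negation using (¬_; contradiction)
open import Relation.Unary using (Decidable; ∁)
open import Relation.Unary.Properties using (∁?)

-- Counting: bijections between lists, and convolutions as numbers of pairs.

private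
  variable
    A B : Set

-- The list `map f xs` has no repetitions, since `map g` takes it back to `xs`, and it has the same
-- members as `ys`. Two repetition-free lists with the same members are permutations of each other.
-- The maps need to be inverse only on listed elements.
inverses⇒length-≡ : {xs : List A} {ys : List B} (f : A → B) (g : B → A) →
  Unique xs → Unique ys →
  (∀ {x} → x ∈ xs → f x ∈ ys × g (f x) ≡ x) →
  (∀ {y} → y ∈ ys → g y ∈ xs × f (g y) ≡ y) →
  length xs ≡ length ys
inverses⇒length-≡ {xs = xs} {ys} f g xs! ys! f-ok g-ok =
  trans (sym (length-map f xs))
        (Perm.↭-length (∼bag⇒↭ (unique∧set⇒bag fxs! ys! (mk⇔ to from))))
  where
  gfxs≡xs : map g (map f xs) ≡ xs
  gfxs≡xs = trans (sym (map-∘ xs)) (map-id-local (All.tabulate (proj₂ ∘ f-ok)))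

  fxs! : Unique (map f xs)
  fxs! = Unique.map⁻ (subst Unique (sym gfxs≡xs) xs!)

  to : ∀ {y} → y ∈ map f xs → y ∈ ys
  to m with _ , x∈ , refl ← ∈-map⁻ f m = proj₁ (f-ok x∈)

  from : ∀ {y} → y ∈ ys → y ∈ map f xs
  from y∈ = subst (_∈ map f xs) (proj₂ (g-ok y∈)) (∈-map⁺ f (proj₁ (g-ok y∈)))

length-cartesianProduct : (xs : List A) (ys : List B) →
  length (cartesianProduct xs ys) ≡ length xs * length ys
length-cartesianProduct []       ys = refl
length-cartesianProduct (x ∷ xs) ys =
  trans (length-++ (map (x ,_) ys))
        (cong₂ _+_ (length-map (x ,_) ys) (length-cartesianProduct xs ys))

length-concat-map : (f : A → List B) (xs : List A) →
  length (concat (map f xs)) ≡ sum (map (length ∘ f) xs)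
length-concat-map f []       = refl
length-concat-map f (x ∷ xs) =
  trans (length-++ (f x)) (cong (length (f x) +_) (length-concat-map f xs))

pairs : (ℕ → List A) → (ℕ → List B) → ℕ → List (A × B)
pairs F G n = concat (map (λ j → cartesianProduct (F j) (G (n ∸ j))) (upTo (suc n)))

module _ (F : ℕ → List A) (G : ℕ → List B) where

  convolution-length : ∀ n →
    convolution (length ∘ F) (length ∘ G) n ≡ length (pairs F G n)
  convolution-length n = trans (cong sum (map-cong length-product (upTo (suc n))))
                               (sym (length-concat-map products (upTo (suc n))))
    where
    products : ℕ → List (A × B)
    products j = cartesianProduct (F j) (G (n ∸ j))

    length-product : ∀ j → length (F j) * length (G (n ∸ j)) ≡ length (products j)
    length-product j = sym (length-cartesianProduct (F j) (G (n ∸ j)))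

  -- Phrased with `i + j ≡ n`, so that the bijection below never meets truncated subtraction.
  ∈-pairs⁺ : ∀ {i j n x y} → i + j ≡ n → x ∈ F i → y ∈ G j → (x , y) ∈ pairs F G n
  ∈-pairs⁺ {i} {j} refl x∈ y∈ =
    ∈-concat⁺′ (∈-cartesianProduct⁺ x∈ (subst (λ k → _ ∈ G k) (sym (m+n∸m≡n i j)) y∈))
               (∈-map⁺ _ (∈-upTo⁺ (s≤s (m≤m+n i j))))

  ∈-pairs⁻ : ∀ {n x y} → (x , y) ∈ pairs F G n →
             ∃₂ λ i j → i + j ≡ n × x ∈ F i × y ∈ G j
  ∈-pairs⁻ {n} m
    with _ , xy∈ , m′ ← ∈-concat⁻′ (map _ (upTo (suc n))) m
    with i , i∈ , refl ← ∈-map⁻ _ m′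
    -- Membership in `upTo (suc n)` gives `i ≤ n`, so `n ∸ i` is a genuine difference.
    = i , n ∸ i , m+[n∸m]≡n (s≤s⁻¹ (∈-upTo⁻ i∈)) , ∈-cartesianProduct⁻ (F i) _ xy∈

  -- A pair does not record the index of its block. Since `size` recovers that index from the first
  -- component, blocks with different indices are disjoint.
  pairs-unique : (size : A → ℕ) → (∀ {i x} → x ∈ F i → size x ≡ i) →
    (∀ i → Unique (F i)) → (∀ j → Unique (G j)) → ∀ n → Unique (pairs F G n)
  pairs-unique size size≡ F! G! n = Unique.concat⁺
    (All.map⁺ (All.universal (λ j → Unique.cartesianProduct⁺ (F! j) (G! (n ∸ j))) _))
    (AllPairs.map⁺ (AllPairs.map disjoint (Unique.upTo⁺ (suc n))))
    where
    disjoint : ∀ {i j} → i ≢ j → ∀ {xy} →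
      ¬ (xy ∈ cartesianProduct (F i) (G (n ∸ i)) ×
         xy ∈ cartesianProduct (F j) (G (n ∸ j)))
    disjoint {i} {j} i≢j (m , m′) = i≢j
      (trans (sym (size≡ (proj₁ (∈-cartesianProduct⁻ (F i) _ m))))
             (size≡ (proj₁ (∈-cartesianProduct⁻ (F j) _ m′))))

-- Separating a list by a decidable predicate.

module _ {P : A → Set} (P? : Decidable P) where

  filter-∁-↭ : ∀ xs → filter P? xs ++ filter (∁? P?) xs ↭ xs
  filter-∁-↭ xs =
    ↭-sym (toPermutation (Interleaving.filter⁺ (setoid A) P? xs))

  module _ {xs ys zs : List A} (zs↭ : zs ↭ xs ++ ys)
           (Pxs : All P xs) (¬Pys : All (∁ P) ys) where
    open PermutationReasoning

    -- Undoes a merge: in whatever order `zs` lists its elements, the predicate separates the two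
    -- blocks again, up to permutation.
    filter-↭-++ˡ : filter P? zs ↭ xs
    filter-↭-++ˡ = begin
      filter P? zs                 ↭⟨ Perm.filter-↭ P? zs↭ ⟩
      filter P? (xs ++ ys)         ≡⟨ filter-++ P? xs ys ⟩
      filter P? xs ++ filter P? ys ≡⟨ cong₂ _++_ (filter-all P? Pxs) (filter-none P? ¬Pys) ⟩
      xs ++ []                     ≡⟨ ++-identityʳ xs ⟩
      xs                           ∎

    filter-↭-++ʳ : filter (∁? P?) zs ↭ ys
    filter-↭-++ʳ = begin
      filter ¬P? zs                  ↭⟨ Perm.filter-↭ ¬P? zs↭ ⟩
      filter ¬P? (xs ++ ys)          ≡⟨ filter-++ ¬P? xs ys ⟩
      -- Partially applied, `contradiction` turns `P x` into its double negation, which rules `x`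
      -- out of the complement.
      filter ¬P? xs ++ filter ¬P? ys ≡⟨ cong₂ _++_
        (filter-none ¬P? (All.map contradiction Pxs)) (filter-all ¬P? ¬Pys) ⟩
      ys                             ∎
      where
      ¬P? = ∁? P?

-- Uniqueness of sorted arrangements, and the orders on parts.

module _ {_≼_ : Rel A 0ℓ} (isDecTotalOrder : IsDecTotalOrder _≡_ _≼_) where
  private
    O : DecTotalOrder 0ℓ 0ℓ 0ℓ
    O = record { isDecTotalOrder = isDecTotalOrder }
  open DecTotalOrder O using (totalOrder)

  -- Antisymmetry leaves a multiset only one sorted arrangement.
  sorted-↭⇒≡ : ∀ {xs ys} → Linked _≼_ xs → Linked _≼_ ys → xs ↭ ys → xs ≡ ys
  sorted-↭⇒≡ xs↗ ys↗ xs↭ys =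
    Pointwise.Pointwise-≡⇒≡ (↗↭↗⇒≋ totalOrder xs↗ ys↗ (↭⇒↭ₛ xs↭ys))

≥-isDecTotalOrder : IsDecTotalOrder _≡_ _≥_
≥-isDecTotalOrder = Flip.isDecTotalOrder ≤-isDecTotalOrder

-- The order is lexicographic, strict on sizes and non-strict on colours. For antisymmetry, a strict
-- comparison of sizes cannot be reversed, so the sizes agree and the colours decide. The flips
-- arise because both component orders are descending.
≽-isDecTotalOrder : IsDecTotalOrder _≡_ _≽_
≽-isDecTotalOrder = record
  { isTotalOrder = record
    { isPartialOrder = record
      { isPreorder = record
        { isEquivalence = isEquivalence
        ; reflexive     = λ where refl → inj₂ (refl , Fin.≤-refl)
        ; trans         = ×-transitive {_<₂_ = Fin._≥_} isEquivalence
                            (resp₂ _>_) (flip <-trans) (flip Fin.≤-trans)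
        }
      ; antisym = antisym
      }
    ; total = ×-total₂ {_<₂_ = Fin._≥_} sym
                (Flip.compare _<_ <-cmp) (flip Fin.≤-total)
    }
  ; _≟_  = ≡-dec _≟_ Fin._≟_
  ; _≤?_ = _≽?_
  }
  where
  antisym : ∀ {c d} → c ≽ d → d ≽ c → c ≡ d
  antisym (inj₁ d<c)        (inj₁ c<d)        = contradiction c<d (<-asym d<c)
  antisym (inj₁ d<c)        (inj₂ (refl , _)) = contradiction d<c (<-irrefl refl)
  antisym (inj₂ (refl , _)) (inj₁ c<d)        = contradiction c<d (<-irrefl refl)
  antisym (inj₂ (refl , u)) (inj₂ (_ , v))    = cong (_ ,_) (Fin.≤-antisym v u)

≥-decTotalOrder ≽-decTotalOrder : DecTotalOrder 0ℓ 0ℓ 0ℓ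
≥-decTotalOrder = record { isDecTotalOrder = ≥-isDecTotalOrder }
≽-decTotalOrder = record { isDecTotalOrder = ≽-isDecTotalOrder }

module SortParts = Sort ≥-decTotalOrder
module SortColoured = Sort ≽-decTotalOrder

-- The two maps and their effect on multisets of parts.

Primary : ColouredPart → Set
Primary c = proj₂ c ≡ Fin.zero

primary? : Decidable Primary
primary? c = proj₂ c Fin.≟ Fin.zero

-- Colour zero holds the parts of the arbitrary partition. Colour one holds the even parts taken
-- from the partition with distinct odd parts.
primary secondary : ℕ → ColouredPart
primary   m = m , Fin.zero
secondary m = m , Fin.suc Fin.zero

oddParts evenParts : List ℕ → List ℕ
oddParts  = filter odd?
evenParts = filter (∁? odd?)

primaryParts secondaryParts : List ColouredPart → List ℕ
primaryParts   = map proj₁ ∘ filter primary?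
secondaryParts = map proj₁ ∘ filter (∁? primary?)

-- Sorting restores the canonical listing. Later arguments use only that the result is sorted and
-- that it satisfies `colour-↭`.
colour : List ℕ → List ℕ → List ColouredPart
colour xs ys = SortColoured.sort (map primary xs ++ map secondary ys)

merge : List ℕ → List ℕ → List ℕ
merge xs ys = SortParts.sort (xs ++ ys)

colour-↭ : ∀ xs ys → colour xs ys ↭ map primary xs ++ map secondary ys
colour-↭ xs ys = SortColoured.sort-↭ _

merge-↭ : ∀ xs ys → merge xs ys ↭ xs ++ ys
merge-↭ xs ys = SortParts.sort-↭ _

≽⇒≥ : ∀ {c d} → c ≽ d → proj₁ c ≥ proj₁ d
≽⇒≥ (inj₁ d<c)        = <⇒≤ d<c
≽⇒≥ (inj₂ (refl , _)) = ≤-refl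

map-proj₁-map : ∀ {f : ℕ → ColouredPart} → (∀ m → proj₁ (f m) ≡ m) →
                ∀ xs → map proj₁ (map f xs) ≡ xs
map-proj₁-map eq xs = trans (sym (map-∘ xs)) (map-id-local (All.universal eq xs))

sum-merge : ∀ xs ys → sum (merge xs ys) ≡ sum xs + sum ys
sum-merge xs ys = trans (sum-↭ (merge-↭ xs ys)) (sum-++ xs ys)

sum-filter : {P : ℕ → Set} (P? : Decidable P) → ∀ xs →
             sum (filter P? xs) + sum (filter (∁? P?) xs) ≡ sum xs
sum-filter P? xs = trans (sym (sum-++ (filter P? xs) _)) (sum-↭ (filter-∁-↭ P? xs))

parts-↭ : ∀ cs → primaryParts cs ++ secondaryParts cs ↭ map proj₁ cs
parts-↭ cs = ↭-trans (↭-reflexive (sym (map-++ proj₁ (filter primary? cs) _)))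
                     (Perm.map⁺ proj₁ (filter-∁-↭ primary? cs))

map-proj₁-colour : ∀ xs ys → map proj₁ (colour xs ys) ↭ xs ++ ys
map-proj₁-colour xs ys = begin
  map proj₁ (colour xs ys)                           ↭⟨ Perm.map⁺ proj₁ (colour-↭ xs ys) ⟩
  map proj₁ (map primary xs ++ map secondary ys)     ≡⟨ map-++ proj₁ (map primary xs) _ ⟩
  map proj₁ (map primary xs) ++ map proj₁ (map secondary ys)
    ≡⟨ cong₂ _++_ (map-proj₁-map (λ _ → refl) xs) (map-proj₁-map (λ _ → refl) ys) ⟩
  xs ++ ys ∎
  where open PermutationReasoning

-- Here `xs` is the partition with distinct odd parts and `ys` the arbitrary one. The maps act on
-- bare lists, as the enumerations do; that they respect the partition predicates is proved
-- separately.
to : List ℕ × List ℕ → List ColouredPart × List ℕ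
to (xs , ys) = colour ys (evenParts xs) , oddParts xs

from : List ColouredPart × List ℕ → List ℕ × List ℕ
from (cs , zs) = merge zs (secondaryParts cs) , primaryParts cs

-- Both maps produce partitions of the required kinds.

≥-filter⁺ : {P : ℕ → Set} (P? : Decidable P) → ∀ {xs} →
            Linked _≥_ xs → Linked _≥_ (filter P? xs)
≥-filter⁺ P? = Linked.filter⁺ P? (flip ≤-trans)

primaryParts-↗ : ∀ {cs} → Linked _≽_ cs → Linked _≥_ (primaryParts cs)
primaryParts-↗ cs↗ = Linked.map⁺ (Linked.map ≽⇒≥
  (Linked.filter⁺ primary? (IsDecTotalOrder.trans ≽-isDecTotalOrder) cs↗))

-- Contrapositive of the colour condition: an odd part has colour zero, so a part of another colour
-- is not odd.
secondaryParts-even : ∀ {cs} → All (λ c → Odd (proj₁ c) → Primary c) cs →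
                      All (∁ Odd) (secondaryParts cs)
secondaryParts-even {cs} ok = All.map⁺ (All.zipWith (λ (f , ¬p) odd → ¬p (f odd))
  (All.filter⁺ (∁? primary?) ok , All.all-filter (∁? primary?) cs))

-- The size is left in the form that the construction yields; the weights are compared with `n` only
-- in the final argument.
to-cubic : ∀ {i j xs ys} → IsPodPartition i xs → IsPartition j ys →
           IsCubicPartition (j + sum (evenParts xs)) (colour ys (evenParts xs))
to-cubic {xs = xs} {ys} ((_ , xs>0 , _) , _) (_ , ys>0 , refl) =
  ( Linked.map⁺ (Linked.map ≽⇒≥ cs↗)
  , Perm.All-resp-↭ (↭-sym (map-proj₁-colour ys _))
      (All.++⁺ ys>0 (All.filter⁺ (∁? odd?) xs>0))
  , trans (sum-↭ (map-proj₁-colour ys _)) (sum-++ ys _) )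
  , cs↗
  , Perm.All-resp-↭ (↭-sym (colour-↭ ys _))
      -- The parts of `ys` receive colour zero by construction; the others are even, so the
      -- condition on odd parts holds vacuously.
      (All.++⁺ (All.map⁺ (All.universal (λ _ _ → refl) ys))
               (All.map⁺ (All.map (λ even odd → contradiction odd even)
                                  (All.all-filter (∁? odd?) xs))))
  where
  cs↗ : Linked _≽_ (colour ys (evenParts xs))
  cs↗ = SortColoured.sort-↗ _

to-distinctOdd : ∀ {i xs} → IsPodPartition i xs →
                 IsDistinctOddPartition (sum (oddParts xs)) (oddParts xs)
to-distinctOdd {xs = xs} ((xs↗ , xs>0 , _) , odds!) =
  (≥-filter⁺ odd? xs↗ , All.filter⁺ odd? xs>0 , refl) , All.all-filter odd? xs , odds!

-- Merging adds only even parts to `zs`, so the odd parts of the result are a rearrangement of `zs`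
-- and remain distinct.
from-pod : ∀ {i j cs zs} → IsCubicPartition i cs → IsDistinctOddPartition j zs →
           IsPodPartition (j + sum (secondaryParts cs)) (merge zs (secondaryParts cs))
from-pod {cs = cs} {zs} ((_ , cs>0 , _) , _ , ok) ((_ , zs>0 , refl) , odd , zs!) =
  ( SortParts.sort-↗ _
  , Perm.All-resp-↭ (↭-sym (merge-↭ zs _))
      (All.++⁺ zs>0 (All.map⁺ (All.filter⁺ (∁? primary?) (All.map⁻ cs>0))))
  , sum-merge zs _ )
  , PermSetoid.Unique-resp-↭ (setoid ℕ) (↭⇒↭ₛ (↭-sym
      (filter-↭-++ˡ odd? (merge-↭ zs _) odd (secondaryParts-even ok)))) zs!

from-partition : ∀ {i cs} → IsCubicPartition i cs →
                 IsPartition (sum (primaryParts cs)) (primaryParts cs)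
from-partition {cs = cs} ((_ , cs>0 , _) , cs↗ , _) =
    primaryParts-↗ cs↗
  , All.map⁺ (All.filter⁺ primary? (All.map⁻ cs>0))
  , refl

-- The two maps are mutually inverse.

-- Colour separates `ys` from the even parts of `xs`, and those even parts rejoin the odd ones to
-- give `xs` up to order. Sortedness then gives equality.
from∘to : ∀ {i j xs ys} → IsPodPartition i xs → IsPartition j ys →
          from (to (xs , ys)) ≡ (xs , ys)
from∘to {xs = xs} {ys} ((xs↗ , _) , _) (ys↗ , _) = cong₂ _,_
  (sorted-↭⇒≡ ≥-isDecTotalOrder (SortParts.sort-↗ _) xs↗ (begin
    merge (oddParts xs) (secondaryParts cs) ↭⟨ merge-↭ (oddParts xs) _ ⟩
    oddParts xs ++ secondaryParts cs
      ↭⟨ Perm.++⁺ˡ (oddParts xs) (Perm.map⁺ proj₁ (filter-↭-++ʳ primary? cs↭ prim sec)) ⟩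
    oddParts xs ++ map proj₁ (map secondary (evenParts xs))
      ≡⟨ cong (oddParts xs ++_) (map-proj₁-map (λ _ → refl) _) ⟩
    oddParts xs ++ evenParts xs ↭⟨ filter-∁-↭ odd? xs ⟩
    xs ∎))
  (sorted-↭⇒≡ ≥-isDecTotalOrder (primaryParts-↗ (SortColoured.sort-↗ _)) ys↗ (begin
    primaryParts cs            ↭⟨ Perm.map⁺ proj₁ (filter-↭-++ˡ primary? cs↭ prim sec) ⟩
    map proj₁ (map primary ys) ≡⟨ map-proj₁-map (λ _ → refl) ys ⟩
    ys ∎))
  where
  open PermutationReasoning
  cs  = colour ys (evenParts xs)
  cs↭ = colour-↭ ys (evenParts xs)
  prim : All Primary (map primary ys)
  prim = All.map⁺ (All.universal (λ _ → refl) ys)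
  sec : All (∁ Primary) (map secondary (evenParts xs))
  sec = All.map⁺ (All.universal (λ _ ()) (evenParts xs))

-- Within one colour class the size determines the coloured part, so the forgotten colour can be
-- restored.
map-primary-proj₁ : ∀ cs → map primary (primaryParts cs) ≡ filter primary? cs
map-primary-proj₁ cs = trans (sym (map-∘ (filter primary? cs)))
  (map-id-local (All.map (λ where refl → refl) (All.all-filter primary? cs)))

map-secondary-proj₁ : ∀ cs → map secondary (secondaryParts cs) ≡ filter (∁? primary?) cs
map-secondary-proj₁ cs = trans (sym (map-∘ (filter (∁? primary?) cs)))
  (map-id-local (All.map secondary-proj₁ (All.all-filter (∁? primary?) cs)))
  where
  -- That there are exactly two colours enters here: a part not of colour zero has colour one.
  secondary-proj₁ : ∀ {c} → ¬ Primary c → secondary (proj₁ c) ≡ c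
  secondary-proj₁ {_ , Fin.zero}         ¬p = contradiction refl ¬p
  secondary-proj₁ {_ , Fin.suc Fin.zero} ¬p = refl

-- Now parity does the separating: in the merged list the odd parts are those of `zs` and the even
-- ones are the secondary parts of `cs`. Recolouring gives back both colour classes.
to∘from : ∀ {i j cs zs} → IsCubicPartition i cs → IsDistinctOddPartition j zs →
          to (from (cs , zs)) ≡ (cs , zs)
to∘from {cs = cs} {zs} (_ , cs↗ , ok) ((zs↗ , _) , odd , _) = cong₂ _,_
  (sorted-↭⇒≡ ≽-isDecTotalOrder (SortColoured.sort-↗ _) cs↗ (begin
    colour (primaryParts cs) (evenParts xs) ↭⟨ colour-↭ (primaryParts cs) _ ⟩
    map primary (primaryParts cs) ++ map secondary (evenParts xs)
      ↭⟨ Perm.++⁺ˡ _ (Perm.map⁺ secondary (filter-↭-++ʳ odd? xs↭ odd even)) ⟩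
    map primary (primaryParts cs) ++ map secondary (secondaryParts cs)
      ≡⟨ cong₂ _++_ (map-primary-proj₁ cs) (map-secondary-proj₁ cs) ⟩
    filter primary? cs ++ filter (∁? primary?) cs ↭⟨ filter-∁-↭ primary? cs ⟩
    cs ∎))
  (sorted-↭⇒≡ ≥-isDecTotalOrder (≥-filter⁺ odd? (SortParts.sort-↗ _)) zs↗
    (filter-↭-++ˡ odd? xs↭ odd even))
  where
  open PermutationReasoning
  xs   = merge zs (secondaryParts cs)
  xs↭  = merge-↭ zs (secondaryParts cs)
  even = secondaryParts-even ok

-- The bijection between pairs of total weight `n`.

theorem4p18 : ∀ (n : ℕ) → convolution pod p n ≡ convolution a q-odd n
theorem4p18 n = begin
  convolution pod p n ≡⟨ convolution-length podPartitions partitions n ⟩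
  length (pairs podPartitions partitions n)
    ≡⟨ inverses⇒length-≡ to from
         -- The index of a block is the weight of the first component: `sum` for plain lists, and
         -- `sum ∘ map proj₁` for coloured ones.
         (pairs-unique podPartitions partitions sum
           (λ m → sumOf (proj₁ (∈⇒ ∈-podPartitions m)))
           podPartitions-unique partitions-unique n)
         (pairs-unique cubicPartitions distinctOddPartitions (sum ∘ map proj₁)
           (λ m → sumOf (proj₁ (∈⇒ ∈-cubicPartitions m)))
           cubicPartitions-unique distinctOddPartitions-unique n)
         to-ok from-ok ⟩
  length (pairs cubicPartitions distinctOddPartitions n)
    ≡⟨ convolution-length cubicPartitions distinctOddPartitions n ⟨
  convolution a q-odd n ∎
  where
  open ≡-Reasoning
  open Equivalence renaming (to to ∈⇒; from to ∈⇐)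

  sumOf : ∀ {i xs} → IsPartition i xs → sum xs ≡ i
  sumOf (_ , _ , eq) = eq

  to-ok : ∀ {xy} → xy ∈ pairs podPartitions partitions n →
    to xy ∈ pairs cubicPartitions distinctOddPartitions n × from (to xy) ≡ xy
  to-ok {xs , ys} m with i , j , i+j≡n , x∈ , y∈ ← ∈-pairs⁻ podPartitions partitions m =
      ∈-pairs⁺ cubicPartitions distinctOddPartitions
        {i = j + sum (evenParts xs)} {j = sum (oddParts xs)} total
        (∈⇐ ∈-cubicPartitions (to-cubic px py))
        (∈⇐ ∈-distinctOddPartitions (to-distinctOdd px))
    , from∘to px py
    where
    px : IsPodPartition i xs
    px = ∈⇒ ∈-podPartitions x∈
    py : IsPartition j ys
    py = ∈⇒ ∈-partitions y∈
    -- The even parts of `xs` pass to the component built from `ys`, the odd parts stay, and the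
    -- total weight is unchanged.
    total : j + sum (evenParts xs) + sum (oddParts xs) ≡ n
    total = begin
      j + sum (evenParts xs) + sum (oddParts xs)   ≡⟨ +-assoc j _ _ ⟩
      j + (sum (evenParts xs) + sum (oddParts xs)) ≡⟨ cong (j +_) (+-comm (sum (evenParts xs)) _) ⟩
      j + (sum (oddParts xs) + sum (evenParts xs)) ≡⟨ cong (j +_) (sum-filter odd? xs) ⟩
      j + sum xs                                   ≡⟨ cong (j +_) (sumOf (proj₁ px)) ⟩
      j + i                                        ≡⟨ +-comm j i ⟩
      i + j                                        ≡⟨ i+j≡n ⟩
      n ∎

  from-ok : ∀ {cz} → cz ∈ pairs cubicPartitions distinctOddPartitions n →
    from cz ∈ pairs podPartitions partitions n × to (from cz) ≡ cz
  from-ok {cs , zs} m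
    with i , j , i+j≡n , c∈ , z∈ ← ∈-pairs⁻ cubicPartitions distinctOddPartitions m =
      ∈-pairs⁺ podPartitions partitions
        {i = j + sum (secondaryParts cs)} {j = sum (primaryParts cs)} total
        (∈⇐ ∈-podPartitions (from-pod pc pz))
        (∈⇐ ∈-partitions (from-partition pc))
    , to∘from pc pz
    where
    pc : IsCubicPartition i cs
    pc = ∈⇒ ∈-cubicPartitions c∈
    pz : IsDistinctOddPartition j zs
    pz = ∈⇒ ∈-distinctOddPartitions z∈
    -- Conversely, the secondary parts of `cs` join `zs` and the primary parts remain.
    total : j + sum (secondaryParts cs) + sum (primaryParts cs) ≡ n
    total = begin
      j + sum (secondaryParts cs) + sum (primaryParts cs)   ≡⟨ +-assoc j _ _ ⟩
      j + (sum (secondaryParts cs) + sum (primaryParts cs)) ≡⟨ cong (j +_) (+-comm (sum (secondaryParts cs)) _) ⟩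
      j + (sum (primaryParts cs) + sum (secondaryParts cs)) ≡⟨ cong (j +_) (sum-++ (primaryParts cs) _) ⟨
      j + sum (primaryParts cs ++ secondaryParts cs)        ≡⟨ cong (j +_) (sum-↭ (parts-↭ cs)) ⟩
      j + sum (map proj₁ cs)                                ≡⟨ cong (j +_) (sumOf (proj₁ pc)) ⟩
      j + i                                                 ≡⟨ +-comm j i ⟩
      i + j                                                 ≡⟨ i+j≡n ⟩
      n ∎
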